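{- For every $n\geq 0$ and $a,b\geq 0$, the number of partitions of $n$ having pairing index $a$ and pairing width $b$ equals the number of partitions of $n$ having exactly $a$ parts and largest part $b$.
   Context: For an integer partition $\lambda$, pair equal parts of $\lambda$ as far as possible: for each part size occurring with odd multiplicity exactly one copy remains unpaired, and a part size of even multiplicity is completely paired. Let $r(\lambda)$ be the largest part size that participates in at least one pair (i.e. of multiplicity at least $2$), with $r(\lambda)=0$ if $\lambda$ has distinct parts. Write the unpaired parts (the part sizes of odd multiplicity, each once) in decreasing order $u_1>u_2>\cdots>u_j$ and let $s(\lambda)=u_1-u_2+u_3-u_4+\cdots$ (so $s(\lambda)=0$ if there are no unpaired parts). The pairing index of $\lambda$ is $T(\lambda)=r(\lambda)+s(\lambda)$. The pair span of $\lambda$ is the number of parts of $\lambda$ (counted with multiplicity) that belong to pairs. The residual span of $\lambda$ is $2\bigl(u_1-s(\lambda)\bigr)+1$ if there is at least one unpaired part, and $0$ if there are no unpaired parts. The pairing width $W(\lambda)$ is the larger of the pair span and the residual span. The empty partition has $0$ parts and largest part $0$. -}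

module Defs where

open import Data.Fin.Base using (Fin)
open import Data.List.Base using (List; []; _∷_; length; filter; map; deduplicate)
open import Data.List.Extrema.Nat using (max)
open import Data.List.Relation.Unary.All using (All)
open import Data.List.Relation.Unary.Linked using (Linked)
open import Data.Nat.Base using (ℕ; _+_; _*_; _∸_; _⊔_; _<_; _≥_)
open import Data.Nat.DivMod using (_/_; _%_)
open import Data.Nat.ListAction using (sum)
open import Data.Nat.Properties using (_≟_; _≤?_)
open import Function.Bundles using (_↔_)
open import Relation.Binary.PropositionalEquality.Core using (_≡_)

-- The three proof fields are propositions, so two partitions are equal
-- exactly when their lists of parts are.
record Partition (n : ℕ) : Set where
  field
    parts         : List ℕ
    nonincreasing : Linked _≥_ parts
    positive      : All (0 <_) parts
    total         : sum parts ≡ n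

multiplicity : ℕ → List ℕ → ℕ
multiplicity m xs = length (filter (m ≟_) xs)

-- deduplicate keeps the order of first occurrences, so for a
-- nonincreasing list the results of partSizes, pairedSizes and
-- unpairedParts are strictly decreasing.
partSizes : List ℕ → List ℕ
partSizes = deduplicate _≟_

pairedSizes : List ℕ → List ℕ
pairedSizes xs = filter (λ m → 2 ≤? multiplicity m xs) (partSizes xs)

unpairedParts : List ℕ → List ℕ
unpairedParts xs = filter (λ m → multiplicity m xs % 2 ≟ 1) (partSizes xs)

-- u₁ - u₂ + u₃ - ⋯ = u₁ - (u₂ - (u₃ - ⋯)). On a decreasing list every
-- bracket is at most its leading term, so no subtraction is truncated.
alternatingSum : List ℕ → ℕ
alternatingSum []       = 0
alternatingSum (u ∷ us) = u ∸ alternatingSum us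

-- By the bound above, u₁ ∸ alternatingSum (u₁ ∷ us) is not truncated either.
residual : List ℕ → ℕ
residual []        = 0
residual (u₁ ∷ us) = 2 * (u₁ ∸ alternatingSum (u₁ ∷ us)) + 1

module _ {n : ℕ} (p : Partition n) where
  open Partition p

  numberOfParts : ℕ
  numberOfParts = length parts

  largestPart : ℕ
  largestPart = max 0 parts

  r : ℕ
  r = max 0 (pairedSizes parts)

  s : ℕ
  s = alternatingSum (unpairedParts parts)

  pairingIndex : ℕ
  pairingIndex = r + s

  -- A part size of multiplicity k contributes ⌊k/2⌋ pairs.
  pairSpan : ℕ
  pairSpan = sum (map (λ m → 2 * (multiplicity m parts / 2)) (partSizes parts))

  residualSpan : ℕ
  residualSpan = residual (unpairedParts parts)

  pairingWidth : ℕ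
  pairingWidth = pairSpan ⊔ residualSpan

-- "A has exactly k elements"; k is determined by A.
HasCardinality : Set → ℕ → Set
HasCardinality A k = A ↔ Fin k

{-# OPTIONS --safe #-}

-- Split λ into pairs μ ∪ μ and a partition ν into distinct parts. Doubling the
-- parts of the conjugate of μ gives a partition into even parts, with r(λ) parts
-- and largest part the pair span. Sylvester's fish-hook bijection turns ν into a
-- partition into odd parts, with s(λ) parts and largest part the residual span.
-- Their union has r + s parts, and its largest part is the larger of the spans.
module Submission where

open import Defs
open import Data.Fin.Base as Fin using (Fin)
open import Data.List.Base using (List; []; _∷_; length; filter; map; replicate; _++_; lookup; deduplicate; cartesianProductWith; upTo)
open import Data.List.Extrema.Nat using (max; max≤v⁺; v≤max⁺)
open import Data.List.Membership.Propositional using (_∈_; lose)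
open import Data.List.Membership.Propositional.Properties using (∈-filter⁺; ∈-filter⁻; ∈-lookup; ∈-upTo⁺; ∈-cartesianProductWith⁺; ∈-deduplicate⁺; ∈-deduplicate⁻)
open import Data.List.Properties using (filter-accept; filter-reject; filter-all; filter-none; filter-idem; map-cong-local; length-map; length-++; length-replicate; ∷-injective; ≡-dec)
open import Data.List.Relation.Unary.All as All using (All; []; _∷_)
import Data.List.Relation.Unary.All.Properties as Allₚ
open import Data.List.Relation.Unary.AllPairs as AllPairs using (AllPairs; []; _∷_)
open import Data.List.Relation.Unary.Any using (here; there; index)
open import Data.List.Relation.Unary.Any.Properties using (lookup-index)
open import Data.List.Relation.Unary.Linked as Linked using (Linked)
open import Data.List.Relation.Unary.Linked.Properties using (AllPairs⇒Linked; Linked⇒AllPairs)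
open import Data.List.Relation.Unary.Unique.Propositional using (Unique)
open import Data.List.Relation.Unary.Unique.DecPropositional.Properties using (deduplicate-!)
open import Data.Nat.Base using (ℕ; zero; suc; _+_; _*_; _⊔_; _≤_; _<_; _≥_; _>_; z≤n; s≤s; z<s; s≤s⁻¹)
open import Data.Nat.DivMod using (_/_; _%_; m/n≡1+[m∸n]/n)
open import Data.Nat.ListAction using (sum)
open import Data.Nat.Properties
open import Algebra.Properties.CommutativeSemigroup +-commutativeSemigroup using (x∙yz≈y∙xz)
open import Data.Nat.Tactic.RingSolver using (solve-∀)
open import Data.Product.Base using (_×_; _,_; proj₁; proj₂; Σ-syntax; ∃-syntax; ∃₂)
open import Data.Sum.Base using (_⊎_; inj₁; inj₂)
open import Function.Base using (_∘_; flip)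
open import Function.Bundles using (_↔_; mk↔ₛ′)
open import Function.Properties.Inverse using (↔-trans)
open import Level using (0ℓ)
open import Relation.Binary.PropositionalEquality
open import Relation.Nullary.Decidable using (Dec; yes; no; ¬?; _×-dec_)
open import Relation.Nullary.Negation using (contradiction)
open import Relation.Unary using (Pred; Decidable)

-- Pairing, merging and Sylvester's step are inductive relations rather than functions. Each is
-- shown to be total and single-valued in both directions, and the statistics follow by induction on
-- derivations. Defining equations stand as arguments of constructors, which keeps the indices free
-- of arithmetic, so two derivations over the same list can be matched against each other. The
-- formulas have these origins. Conjugation turns the largest pair size into a number of parts and
-- the number of pairs into a largest part; doubling makes the latter the pair span and accounts for
-- the two copies of each paired part. In the fish-hook diagram, u₁ is the height s of the middle
-- column plus half of the first row, so 2(u₁ - s) + 1 is the full length of that row. Parity lets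
-- the union be split again. The common cardinality k is found by enumerating only the partitions
-- with prescribed number of parts and largest part; the bijection carries it over.

private
  variable
    x k m n : ℕ
    xs ys κ κ′ es es′ os os′ μ μ′ ν ν′ α α′ : List ℕ
    P : Pred ℕ 0ℓ

Nonincreasing Decreasing : List ℕ → Set
Nonincreasing = AllPairs _≥_
Decreasing    = AllPairs _>_

Positive : List ℕ → Set
Positive = All (0 <_)

top : List ℕ → ℕ
top []      = 0
top (x ∷ _) = x

nonincreasing⇒max≡top : Nonincreasing xs → max 0 xs ≡ top xs
nonincreasing⇒max≡top []       = refl
nonincreasing⇒max≡top {x ∷ xs} (p ∷ ps) =
  ≤-antisym (max≤v⁺ {xs = x ∷ xs} z≤n (≤-refl ∷ p)) (v≤max⁺ 0 (x ∷ xs) (inj₂ (here ≤-refl)))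

-- Pairing equal parts

-- The strict bound in `single` forbids leaving a part unpaired while an equal one follows. This
-- forces maximal pairing, and it determines the constructor from the list.
data Pairing : List ℕ → List ℕ → List ℕ → Set where
  []     : Pairing [] [] []
  pair   : All (x ≥_) xs → Pairing xs μ ν → Pairing (x ∷ x ∷ xs) (x ∷ μ) ν
  single : All (x >_) xs → Pairing xs μ ν → Pairing (x ∷ xs) μ (x ∷ ν)

pairing-All⁻ : Pairing xs μ ν → All P xs → All P μ × All P ν
pairing-All⁻ []           []             = [] , []
pairing-All⁻ (pair _ p)   (px ∷ _ ∷ pxs) = let pμ , pν = pairing-All⁻ p pxs in px ∷ pμ , pν
pairing-All⁻ (single _ p) (px ∷ pxs)     = let pμ , pν = pairing-All⁻ p pxs in pμ , px ∷ pν

pairing-All⁺ : Pairing xs μ ν → All P μ → All P ν → All P xs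
pairing-All⁺ []           _         _         = []
pairing-All⁺ (pair _ p)   (px ∷ pμ) pν        = px ∷ px ∷ pairing-All⁺ p pμ pν
pairing-All⁺ (single _ p) pμ        (px ∷ pν) = px ∷ pairing-All⁺ p pμ pν

pairing-nonincreasing : Pairing xs μ ν → Nonincreasing xs
pairing-nonincreasing []           = []
pairing-nonincreasing (pair b p)   = (≤-refl ∷ b) ∷ b ∷ pairing-nonincreasing p
pairing-nonincreasing (single b p) = All.map <⇒≤ b ∷ pairing-nonincreasing p

pairing-pairs-nonincreasing : Pairing xs μ ν → Nonincreasing μ
pairing-pairs-nonincreasing []           = []
pairing-pairs-nonincreasing (pair b p)   = proj₁ (pairing-All⁻ p b) ∷ pairing-pairs-nonincreasing p
pairing-pairs-nonincreasing (single _ p) = pairing-pairs-nonincreasing p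

pairing-singles-decreasing : Pairing xs μ ν → Decreasing ν
pairing-singles-decreasing []           = []
pairing-singles-decreasing (pair _ p)   = pairing-singles-decreasing p
pairing-singles-decreasing (single b p) = proj₂ (pairing-All⁻ p b) ∷ pairing-singles-decreasing p

unpair : ∀ xs → Nonincreasing xs → ∃₂ λ μ ν → Pairing xs μ ν
unpair []           _  = _ , _ , []
unpair (x ∷ [])     _  = _ , _ , single [] []
unpair (x ∷ y ∷ xs) ((y≤x ∷ b) ∷ ps) with x ≟ y | unpair xs (AllPairs.tail ps) | unpair (y ∷ xs) ps
... | yes refl | _ , _ , p | _         = _ , _ , pair b p
... | no  x≢y  | _         | _ , _ , p =
  _ , _ , single (y<x ∷ All.map (λ z≤y → ≤-<-trans z≤y y<x) (AllPairs.head ps)) p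
  where y<x = ≤∧≢⇒< y≤x (x≢y ∘ sym)

repair : ∀ μ ν → Nonincreasing μ → Decreasing ν → ∃[ xs ] Pairing xs μ ν
repair []      []      _        _        = _ , []
repair []      (y ∷ ν) _        (c ∷ cs) = let _ , p = repair [] ν [] cs in _ , single (pairing-All⁺ p [] c) p
repair (x ∷ μ) []      (b ∷ bs) _        = let _ , p = repair μ [] bs [] in _ , pair (pairing-All⁺ p b []) p
repair (x ∷ μ) (y ∷ ν) (b ∷ bs) (c ∷ cs)
  with y ≤? x | repair μ (y ∷ ν) bs (c ∷ cs) | repair (x ∷ μ) ν (b ∷ bs) cs
-- A tie x = y goes to the pair, because `single` must exceed everything after it.
... | yes y≤x | _ , p | _     =
  _ , pair (pairing-All⁺ p b (y≤x ∷ All.map (λ z<y → <⇒≤ (<-≤-trans z<y y≤x)) c)) p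
... | no  y≰x | _     | _ , p =
  _ , single (pairing-All⁺ p (x<y ∷ All.map (λ z≤x → ≤-<-trans z≤x x<y) b) c) p
  where x<y = ≰⇒> y≰x

pairing-functional : Pairing xs μ ν → Pairing xs μ′ ν′ → μ ≡ μ′ × ν ≡ ν′
pairing-functional []           []           = refl , refl
pairing-functional (pair _ p)   (pair _ q)   = let e , e′ = pairing-functional p q in cong (_ ∷_) e , e′
pairing-functional (pair _ _)   (single (b ∷ _) _) = contradiction b (<-irrefl refl)
pairing-functional (single (b ∷ _) _) (pair _ _)   = contradiction b (<-irrefl refl)
pairing-functional (single _ p) (single _ q) = let e , e′ = pairing-functional p q in e , cong (_ ∷_) e′

-- Comparing the top pair x with the top single y decides the constructor: starting with the pair
-- gives y ≤ x, starting with the single gives x < y.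
pairing-injective : Pairing xs μ ν → Pairing ys μ ν → xs ≡ ys
pairing-injective []           []           = refl
pairing-injective (pair _ p)   (pair _ q)   = cong (λ zs → _ ∷ _ ∷ zs) (pairing-injective p q)
pairing-injective (pair b p)   (single c q) =
  contradiction (All.head (proj₂ (pairing-All⁻ p b))) (<⇒≱ (All.head (proj₁ (pairing-All⁻ q c))))
pairing-injective (single b p) (pair c q)   =
  contradiction (All.head (proj₂ (pairing-All⁻ q c))) (<⇒≱ (All.head (proj₁ (pairing-All⁻ p b))))
pairing-injective (single _ p) (single _ q) = cong (_ ∷_) (pairing-injective p q)

pairing-sum : Pairing xs μ ν → sum xs ≡ 2 * sum μ + sum ν
pairing-sum []                   = refl
pairing-sum (pair {x} {μ = μ} {ν} _ p) rewrite pairing-sum p = lemma x (sum μ) (sum ν)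
  where
  lemma : ∀ x u v → x + (x + (2 * u + v)) ≡ 2 * (x + u) + v
  lemma = solve-∀
pairing-sum (single {x} {μ = μ} {ν} _ p) rewrite pairing-sum p = lemma x (sum μ) (sum ν)
  where
  lemma : ∀ x u v → x + (2 * u + v) ≡ 2 * u + (x + v)
  lemma = solve-∀

-- Multiplicities and the statistics of a pairing

multiplicity-head : ∀ x xs → multiplicity x (x ∷ xs) ≡ suc (multiplicity x xs)
multiplicity-head x xs = cong length (filter-accept (x ≟_) refl)

multiplicity-tail : ∀ xs → m ≢ x → multiplicity m (x ∷ xs) ≡ multiplicity m xs
multiplicity-tail xs m≢x = cong length (filter-reject (_ ≟_) m≢x)

multiplicity-absent : All (x >_) xs → multiplicity x xs ≡ 0
multiplicity-absent b = cong length (filter-none (_ ≟_) (All.map >⇒≢ b))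

multiplicity-pair-head : ∀ x xs → multiplicity x (x ∷ x ∷ xs) ≡ 2 + multiplicity x xs
multiplicity-pair-head x xs =
  trans (multiplicity-head x (x ∷ xs)) (cong suc (multiplicity-head x xs))

multiplicity-pair-tail : ∀ xs → m ≢ x → multiplicity m (x ∷ x ∷ xs) ≡ multiplicity m xs
multiplicity-pair-tail xs m≢x = trans (multiplicity-tail (_ ∷ xs) m≢x) (multiplicity-tail xs m≢x)

partSizes-All : All P xs → All P (partSizes xs)
partSizes-All = Allₚ.deduplicate⁺ _≟_

partSizes-fresh : All (x >_) xs → partSizes (x ∷ xs) ≡ x ∷ partSizes xs
partSizes-fresh b = cong (_ ∷_) (filter-all _ (All.map >⇒≢ (partSizes-All b)))

partSizes-repeat : ∀ x xs → partSizes (x ∷ x ∷ xs) ≡ partSizes (x ∷ xs)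
partSizes-repeat x xs = cong (x ∷_) (trans (filter-reject ≢x? (λ x≢x → x≢x refl)) (filter-idem ≢x? (partSizes xs)))
  where ≢x? = ¬? ∘ (x ≟_)

-- In a nonincreasing list bounded by x, the size x can occur only from the head on. So a pair in
-- front either enlarges the multiplicity of the present first size or introduces a new one. The
-- exclusion of x from `zs` ensures that the other multiplicities do not change.
partSizes-pair : All (x ≥_) xs → Nonincreasing xs →
  (∃[ zs ] partSizes xs ≡ x ∷ zs × partSizes (x ∷ x ∷ xs) ≡ x ∷ zs × All (_≢ x) zs)
  ⊎ (All (x >_) xs × partSizes (x ∷ x ∷ xs) ≡ x ∷ partSizes xs)
partSizes-pair {x} [] [] = inj₂ ([] , partSizes-repeat x [])
partSizes-pair {x} {y ∷ xs} (y≤x ∷ _) (b ∷ _) with x ≟ y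
... | yes refl = inj₁ (_ , refl , trans (partSizes-repeat x (x ∷ xs)) (partSizes-repeat x xs) ,
                       All.map (_∘ sym) (Allₚ.all-filter _ (partSizes xs)))
... | no  x≢y  = inj₂ (all> , trans (partSizes-repeat x (y ∷ xs)) (partSizes-fresh all>))
  where
  y<x  = ≤∧≢⇒< y≤x (x≢y ∘ sym)
  all> = y<x ∷ All.map (λ z≤y → ≤-<-trans z≤y y<x) b

-- Serves to change the list in which multiplicities are counted inside a filter test, when the
-- counts agree on the sizes tested.
filter-∘-cong : (P? : Decidable P) {f g : ℕ → ℕ} → All (λ x → f x ≡ g x) xs →
  filter (P? ∘ f) xs ≡ filter (P? ∘ g) xs
filter-∘-cong P? []                     = refl
filter-∘-cong P? {f} {g} (_∷_ {x} e es) rewrite e with P? (g x)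
... | yes _ = cong (x ∷_) (filter-∘-cong P? es)
... | no  _ = filter-∘-cong P? es

multiplicity-pair-parity : ∀ m x xs → multiplicity m (x ∷ x ∷ xs) % 2 ≡ multiplicity m xs % 2
multiplicity-pair-parity m x xs with m ≟ x
... | yes refl = cong (_% 2) (multiplicity-pair-head x xs)
... | no  m≢x  = cong (_% 2) (multiplicity-pair-tail xs m≢x)

unpairedParts-pair : All (x ≥_) xs → Nonincreasing xs → unpairedParts (x ∷ x ∷ xs) ≡ unpairedParts xs
unpairedParts-pair {x} {xs} b ps = trans (filter-∘-cong (_≟ 1) {g = λ m → multiplicity m xs % 2}
  (All.universal (λ m → multiplicity-pair-parity m x xs) (partSizes (x ∷ x ∷ xs)))) sizes
  where
  odd? = λ m → multiplicity m xs % 2 ≟ 1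
  sizes : filter odd? (partSizes (x ∷ x ∷ xs)) ≡ filter odd? (partSizes xs)
  sizes with partSizes-pair b ps
  ... | inj₁ (_ , e , e′ , _) = cong (filter odd?) (trans e′ (sym e))
  -- The new size x has multiplicity 0 in `xs`, which is even, so the test drops it.
  ... | inj₂ (x>xs , e)       = trans (cong (filter odd?) e)
    (filter-reject odd? (λ o → 0≢1+n (trans (cong (_% 2) (sym (multiplicity-absent x>xs))) o)))

multiplicities-tail : All (x >_) xs → All (λ m → multiplicity m (x ∷ xs) ≡ multiplicity m xs) (partSizes xs)
multiplicities-tail {xs = xs} b = All.map (multiplicity-tail xs ∘ <⇒≢) (partSizes-All b)

multiplicity-single : All (x >_) xs → multiplicity x (x ∷ xs) ≡ 1
multiplicity-single {x} {xs} b = trans (multiplicity-head x xs) (cong suc (multiplicity-absent b))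

pairing-unpairedParts : Pairing xs μ ν → unpairedParts xs ≡ ν
pairing-unpairedParts []         = refl
pairing-unpairedParts (pair b p) =
  trans (unpairedParts-pair b (pairing-nonincreasing p)) (pairing-unpairedParts p)
pairing-unpairedParts (single {x} {xs} {ν = ν} b p) = begin
  unpairedParts (x ∷ xs)                                 ≡⟨ cong (filter odd?) (partSizes-fresh b) ⟩
  filter odd? (x ∷ partSizes xs)                         ≡⟨ filter-accept odd? (cong (_% 2) (multiplicity-single b)) ⟩
  x ∷ filter odd? (partSizes xs)                         ≡⟨ cong (x ∷_) (filter-∘-cong (λ k → k % 2 ≟ 1) (multiplicities-tail b)) ⟩
  x ∷ unpairedParts xs                                   ≡⟨ cong (x ∷_) (pairing-unpairedParts p) ⟩
  x ∷ ν                                                  ∎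
  where
  open ≡-Reasoning
  odd? = λ m → multiplicity m (x ∷ xs) % 2 ≟ 1

-- The head of a `pair` bounds all sizes and occurs at least twice, so it is the maximum at once.
-- The head of a `single` has multiplicity 1 and is filtered out, leaving the other multiplicities
-- as they were.
pairing-pairedSizes : Pairing xs μ ν → max 0 (pairedSizes xs) ≡ top μ
pairing-pairedSizes []         = refl
pairing-pairedSizes (pair {x} {xs} b p) = ≤-antisym
  (max≤v⁺ {xs = pairedSizes (x ∷ x ∷ xs)} z≤n (Allₚ.filter⁺ many? (partSizes-All (≤-refl ∷ ≤-refl ∷ b))))
  (v≤max⁺ 0 _ (inj₂ (lose (∈-filter⁺ many? (here refl)
    (subst (2 ≤_) (sym (multiplicity-pair-head x xs)) (s≤s (s≤s z≤n)))) ≤-refl)))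
  where many? = λ m → 2 ≤? multiplicity m (x ∷ x ∷ xs)
pairing-pairedSizes (single {x} {xs} {μ} b p) = begin
  max 0 (pairedSizes (x ∷ xs))            ≡⟨ cong (max 0 ∘ filter many?) (partSizes-fresh b) ⟩
  max 0 (filter many? (x ∷ partSizes xs)) ≡⟨ cong (max 0) (filter-reject many? {x} {partSizes xs} (<⇒≱ (s≤s (≤-reflexive (multiplicity-single b))))) ⟩
  max 0 (filter many? (partSizes xs))     ≡⟨ cong (max 0) (filter-∘-cong (2 ≤?_) (multiplicities-tail b)) ⟩
  max 0 (pairedSizes xs)                  ≡⟨ pairing-pairedSizes p ⟩
  top μ                                   ∎
  where
  open ≡-Reasoning
  many? = λ m → 2 ≤? multiplicity m (x ∷ xs)

pairedCopies : ℕ → ℕ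
pairedCopies k = 2 * (k / 2)

pairedCopies-2+ : ∀ k → pairedCopies (2 + k) ≡ 2 + pairedCopies k
pairedCopies-2+ k = trans (cong (2 *_) (m/n≡1+[m∸n]/n {2 + k} {2} (s≤s (s≤s z≤n)))) (*-suc 2 (k / 2))

-- At `partSizes xs` this is the pair span. The sizes are a separate argument so that they and the
-- list behind the multiplicities can be rewritten independently.
pairedTotal : List ℕ → List ℕ → ℕ
pairedTotal xs sizes = sum (map (λ m → pairedCopies (multiplicity m xs)) sizes)

pairedTotal-cong : ∀ xs ys {zs} → All (λ m → multiplicity m xs ≡ multiplicity m ys) zs →
  pairedTotal xs zs ≡ pairedTotal ys zs
pairedTotal-cong xs ys = cong sum ∘ map-cong-local ∘ All.map (cong pairedCopies)

-- A `pair` raises the total by 2, within the summand of its size or as a new summand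
-- `pairedCopies 2`. A `single` only adds `pairedCopies 1`, which is 0.
pairing-pairSpan : Pairing xs μ ν → pairedTotal xs (partSizes xs) ≡ 2 * length μ
pairing-pairSpan []         = refl
pairing-pairSpan (pair {x} {xs} {μ} b p) = trans grow
  (trans (cong (2 +_) (pairing-pairSpan p)) (sym (*-suc 2 (length μ))))
  where
  open ≡-Reasoning
  xxxs = x ∷ x ∷ xs
  grow : pairedTotal xxxs (partSizes xxxs) ≡ 2 + pairedTotal xs (partSizes xs)
  grow with partSizes-pair b (pairing-nonincreasing p)
  ... | inj₁ (zs , e , e′ , x∉zs) = begin
    pairedTotal xxxs (partSizes xxxs)
      ≡⟨ cong (pairedTotal xxxs) e′ ⟩
    pairedCopies (multiplicity x xxxs) + pairedTotal xxxs zs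
      ≡⟨ cong₂ _+_ (trans (cong pairedCopies (multiplicity-pair-head x xs)) (pairedCopies-2+ (multiplicity x xs)))
                   (pairedTotal-cong xxxs xs (All.map (multiplicity-pair-tail xs) x∉zs)) ⟩
    2 + pairedTotal xs (x ∷ zs)
      ≡⟨ cong (λ ss → 2 + pairedTotal xs ss) e ⟨
    2 + pairedTotal xs (partSizes xs) ∎
  ... | inj₂ (x>xs , e) = begin
    pairedTotal xxxs (partSizes xxxs)
      ≡⟨ cong (pairedTotal xxxs) e ⟩
    pairedCopies (multiplicity x xxxs) + pairedTotal xxxs (partSizes xs)
      ≡⟨ cong₂ _+_ (cong pairedCopies (trans (multiplicity-pair-head x xs) (cong (2 +_) (multiplicity-absent x>xs))))
                   (pairedTotal-cong xxxs xs (All.map (multiplicity-pair-tail xs ∘ <⇒≢) (partSizes-All x>xs))) ⟩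
    2 + pairedTotal xs (partSizes xs) ∎
pairing-pairSpan (single {x} {xs} {μ} b p) = begin
  pairedTotal (x ∷ xs) (partSizes (x ∷ xs))
    ≡⟨ cong (pairedTotal (x ∷ xs)) (partSizes-fresh b) ⟩
  pairedCopies (multiplicity x (x ∷ xs)) + pairedTotal (x ∷ xs) (partSizes xs)
    ≡⟨ cong₂ _+_ (cong pairedCopies (multiplicity-single b)) (pairedTotal-cong (x ∷ xs) xs (multiplicities-tail b)) ⟩
  pairedTotal xs (partSizes xs)
    ≡⟨ pairing-pairSpan p ⟩
  2 * length μ ∎
  where open ≡-Reasoning

-- Conjugation

addColumn : ℕ → List ℕ → List ℕ
addColumn zero    xs       = xs
addColumn (suc k) []       = 1 ∷ addColumn k []
addColumn (suc k) (x ∷ xs) = suc x ∷ addColumn k xs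

conjugate : List ℕ → List ℕ
conjugate []       = []
conjugate (x ∷ xs) = addColumn x (conjugate xs)

top-≤ : All (x ≥_) xs → top xs ≤ x
top-≤ []        = z≤n
top-≤ (y≤x ∷ _) = y≤x

addColumn-length : ∀ k xs → length xs ≤ k → length (addColumn k xs) ≡ k
addColumn-length zero    []       _       = refl
addColumn-length (suc k) []       _       = cong suc (addColumn-length k [] z≤n)
addColumn-length (suc k) (x ∷ xs) (s≤s l) = cong suc (addColumn-length k xs l)

addColumn-sum : ∀ k xs → sum (addColumn k xs) ≡ k + sum xs
addColumn-sum zero    xs       = refl
addColumn-sum (suc k) []       = cong suc (addColumn-sum k [])
addColumn-sum (suc k) (x ∷ xs) = cong suc
  (trans (cong (x +_) (addColumn-sum k xs)) (x∙yz≈y∙xz x k (sum xs)))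

addColumn-All-≥ : ∀ k → All (x ≥_) xs → All (suc x ≥_) (addColumn k xs)
addColumn-All-≥ zero    b        = All.map m≤n⇒m≤1+n b
addColumn-All-≥ (suc k) []       = s≤s z≤n ∷ addColumn-All-≥ k []
addColumn-All-≥ (suc k) (p ∷ ps) = s≤s p ∷ addColumn-All-≥ k ps

addColumn-nonincreasing : ∀ k → Nonincreasing xs → Nonincreasing (addColumn k xs)
addColumn-nonincreasing zero    ps       = ps
addColumn-nonincreasing (suc k) []       = addColumn-All-≥ k [] ∷ addColumn-nonincreasing k []
addColumn-nonincreasing (suc k) (p ∷ ps) = addColumn-All-≥ k p ∷ addColumn-nonincreasing k ps

addColumn-positive : ∀ k → Positive xs → Positive (addColumn k xs)
addColumn-positive zero    ps       = ps
addColumn-positive (suc k) []       = z<s ∷ addColumn-positive k []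
addColumn-positive (suc k) (_ ∷ ps) = z<s ∷ addColumn-positive k ps

conjugate-nonincreasing : ∀ xs → Nonincreasing (conjugate xs)
conjugate-nonincreasing []       = []
conjugate-nonincreasing (x ∷ xs) = addColumn-nonincreasing x (conjugate-nonincreasing xs)

conjugate-positive : ∀ xs → Positive (conjugate xs)
conjugate-positive []       = []
conjugate-positive (x ∷ xs) = addColumn-positive x (conjugate-positive xs)

conjugate-sum : ∀ xs → sum (conjugate xs) ≡ sum xs
conjugate-sum []       = refl
conjugate-sum (x ∷ xs) = trans (addColumn-sum x (conjugate xs)) (cong (x +_) (conjugate-sum xs))

conjugate-length : Nonincreasing xs → length (conjugate xs) ≡ top xs
conjugate-length []                = refl
conjugate-length {x ∷ xs} (b ∷ ps) =
  addColumn-length x (conjugate xs) (≤-trans (≤-reflexive (conjugate-length ps)) (top-≤ b))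

addColumn-top : ∀ k xs → top (addColumn (suc k) xs) ≡ suc (top xs)
addColumn-top k []      = refl
addColumn-top k (_ ∷ _) = refl

conjugate-top : Positive xs → top (conjugate xs) ≡ length xs
conjugate-top []                          = refl
conjugate-top {suc x ∷ xs} (_ ∷ ps) = trans (addColumn-top x (conjugate xs)) (cong suc (conjugate-top ps))

-- By the length bound the new column is at least as tall as all others, so its transpose is a first
-- row. The height is a successor because an empty column would have to become a part 0, which
-- `conjugate` never produces.
conjugate-addColumn : ∀ k xs → length xs ≤ suc k →
  conjugate (addColumn (suc k) xs) ≡ suc k ∷ conjugate xs
conjugate-addColumn zero    []       _       = refl
conjugate-addColumn zero    (x ∷ []) _       = refl
conjugate-addColumn zero    (_ ∷ _ ∷ _) (s≤s ())
conjugate-addColumn (suc k) []       _       = cong (addColumn 1) (conjugate-addColumn k [] z≤n)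
conjugate-addColumn (suc k) (x ∷ xs) (s≤s l) = cong (addColumn (suc x)) (conjugate-addColumn k xs l)

conjugate-involutive : Nonincreasing xs → Positive xs → conjugate (conjugate xs) ≡ xs
conjugate-involutive []                _        = refl
conjugate-involutive {suc x ∷ xs} (b ∷ ps) (_ ∷ qs) = trans
  (conjugate-addColumn x (conjugate xs) (≤-trans (≤-reflexive (conjugate-length ps)) (top-≤ b)))
  (cong (suc x ∷_) (conjugate-involutive ps qs))

-- Merging even and odd parts

-- The last two indices hold halves: x stands for the part 2x in the first of them and for 2x + 1 in
-- the second. Doubling is thus built in here, and the odd halves are the entries that `Sylvester`
-- uses.
data Merging : List ℕ → List ℕ → List ℕ → Set where
  []   : Merging [] [] []
  even : k ≡ 2 * x → All (k ≥_) κ → Merging κ es os → Merging (k ∷ κ) (x ∷ es) os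
  odd  : k ≡ suc (2 * x) → All (k ≥_) κ → Merging κ es os → Merging (k ∷ κ) es (x ∷ os)

merging-All⁺ : Merging κ es os → All (P ∘ (2 *_)) es → All (P ∘ suc ∘ (2 *_)) os → All P κ
merging-All⁺ []              _        _        = []
merging-All⁺ (even refl _ p) (e ∷ pe) po       = e ∷ merging-All⁺ p pe po
merging-All⁺ (odd refl _ p)  pe       (o ∷ po) = o ∷ merging-All⁺ p pe po

merging-All⁻ : Merging κ es os → All P κ → All (P ∘ (2 *_)) es × All (P ∘ suc ∘ (2 *_)) os
merging-All⁻ []              _        = [] , []
merging-All⁻ (even refl _ p) (k ∷ pk) = let pe , po = merging-All⁻ p pk in k ∷ pe , po
merging-All⁻ (odd refl _ p)  (k ∷ pk) = let pe , po = merging-All⁻ p pk in pe , k ∷ po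

merging-nonincreasing : Merging κ es os → Nonincreasing κ
merging-nonincreasing []           = []
merging-nonincreasing (even _ b p) = b ∷ merging-nonincreasing p
merging-nonincreasing (odd _ b p)  = b ∷ merging-nonincreasing p

merging-evens-nonincreasing : Merging κ es os → Nonincreasing es
merging-evens-nonincreasing []              = []
merging-evens-nonincreasing (even refl b p) =
  All.map (*-cancelˡ-≤ 2) (proj₁ (merging-All⁻ p b)) ∷ merging-evens-nonincreasing p
merging-evens-nonincreasing (odd _ _ p)     = merging-evens-nonincreasing p

merging-odds-nonincreasing : Merging κ es os → Nonincreasing os
merging-odds-nonincreasing []             = []
merging-odds-nonincreasing (even _ _ p)   = merging-odds-nonincreasing p
merging-odds-nonincreasing (odd refl b p) =
  All.map (*-cancelˡ-≤ 2 ∘ s≤s⁻¹) (proj₂ (merging-All⁻ p b)) ∷ merging-odds-nonincreasing p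

parity : ∀ k → (∃[ x ] k ≡ 2 * x) ⊎ (∃[ x ] k ≡ suc (2 * x))
parity zero    = inj₁ (0 , refl)
parity (suc k) with parity k
... | inj₁ (x , e) = inj₂ (x , cong suc e)
... | inj₂ (x , e) = inj₁ (suc x , trans (cong suc e) (sym (*-suc 2 x)))

unmerge : Nonincreasing κ → ∃₂ λ es os → Merging κ es os
unmerge []       = _ , _ , []
unmerge {k ∷ κ} (b ∷ bs) with parity k | unmerge bs
... | inj₁ (x , e) | _ , _ , p = _ , _ , even {x = x} e b p
... | inj₂ (x , e) | _ , _ , p = _ , _ , odd {x = x} e b p

double-mono : All (x ≥_) xs → All (λ y → 2 * x ≥ 2 * y) xs
double-mono = All.map (*-monoʳ-≤ 2)

merge : ∀ es os → Nonincreasing es → Nonincreasing os → ∃[ κ ] Merging κ es os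
merge []       []       _        _        = _ , []
merge []       (y ∷ os) _        (c ∷ cs) =
  let _ , p = merge [] os [] cs in _ , odd refl (merging-All⁺ p [] (All.map s≤s (double-mono c))) p
merge (x ∷ es) []       (b ∷ bs) _        =
  let _ , p = merge es [] bs [] in _ , even refl (merging-All⁺ p (double-mono b) []) p
merge (x ∷ es) (y ∷ os) (b ∷ bs) (c ∷ cs)
  with suc (2 * y) ≤? 2 * x | merge es (y ∷ os) bs (c ∷ cs) | merge (x ∷ es) os (b ∷ bs) cs
... | yes y<x | _ , p | _     =
  _ , even refl (merging-All⁺ p (double-mono b) (y<x ∷ All.map (λ l → ≤-trans (s≤s l) y<x) (double-mono c))) p
... | no  y≮x | _     | _ , p =
  _ , odd refl (merging-All⁺ p (x≤y ∷ All.map (λ l → ≤-trans l x≤y) (double-mono b)) (All.map s≤s (double-mono c))) p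
  where x≤y = ≰⇒≥ y≮x

merging-functional : Merging κ es os → Merging κ es′ os′ → es ≡ es′ × os ≡ os′
merging-functional []           []            = refl , refl
merging-functional (even {x = x} e _ p) (even {x = y} e′ _ q) =
  let f , g = merging-functional p q in cong₂ _∷_ (*-cancelˡ-≡ x y 2 (trans (sym e) e′)) f , g
merging-functional (even {x = x} e _ p) (odd {x = y} e′ _ q)  = contradiction (trans (sym e) e′) (even≢odd x y)
merging-functional (odd {x = x} e _ p)  (even {x = y} e′ _ q) = contradiction (trans (sym e′) e) (even≢odd y x)
merging-functional (odd {x = x} e _ p)  (odd {x = y} e′ _ q)  =
  let f , g = merging-functional p q
  in  f , cong₂ _∷_ (*-cancelˡ-≡ x y 2 (suc-injective (trans (sym e) e′))) g

-- If the derivations began with different constructors, each of the two heads would bound the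
-- other, making an even number equal to an odd one.
merging-injective : Merging κ es os → Merging κ′ es os → κ ≡ κ′
merging-injective []              []              = refl
merging-injective (even refl _ p) (even refl _ q) = cong (_ ∷_) (merging-injective p q)
merging-injective (even {x = x} refl b p) (odd {x = y} refl c q) = contradiction
  (≤-antisym (All.head (proj₁ (merging-All⁻ q c))) (All.head (proj₂ (merging-All⁻ p b)))) (even≢odd x y)
merging-injective (odd {x = x} refl b p) (even {x = y} refl c q) = contradiction
  (≤-antisym (All.head (proj₁ (merging-All⁻ p b))) (All.head (proj₂ (merging-All⁻ q c)))) (even≢odd y x)
merging-injective (odd refl _ p)  (odd refl _ q)  = cong (_ ∷_) (merging-injective p q)

merging-length : Merging κ es os → length κ ≡ length es + length os
merging-length []           = refl
merging-length (even _ _ p) = cong suc (merging-length p)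
merging-length {es = es} (odd {os = os} _ _ p)  =
  trans (cong suc (merging-length p)) (sym (+-suc (length es) (length os)))

merging-sum : Merging κ es os → sum κ ≡ 2 * sum es + (length os + 2 * sum os)
merging-sum []                                       = refl
merging-sum (even {x = x} {es = es} {os} refl _ p) rewrite merging-sum p = lemma x (sum es) (sum os) (length os)
  where
  lemma : ∀ x s t l → 2 * x + (2 * s + (l + 2 * t)) ≡ 2 * (x + s) + (l + 2 * t)
  lemma = solve-∀
merging-sum (odd {x = x} {es = es} {os} refl _ p) rewrite merging-sum p = lemma x (sum es) (sum os) (length os)
  where
  lemma : ∀ x s t l → suc (2 * x) + (2 * s + (l + 2 * t)) ≡ 2 * s + (suc l + 2 * (x + t))
  lemma = solve-∀

-- The value 0 on the empty list agrees with the residual span when there are no unpaired parts.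
topOdd : List ℕ → ℕ
topOdd []      = 0
topOdd (x ∷ _) = suc (2 * x)

topOdd-≤ : All (λ y → x ≥ suc (2 * y)) xs → topOdd xs ≤ x
topOdd-≤ []      = z≤n
topOdd-≤ (p ∷ _) = p

topEven-≤ : All (λ y → x ≥ 2 * y) xs → 2 * top xs ≤ x
topEven-≤ []      = z≤n
topEven-≤ (p ∷ _) = p

merging-top : Merging κ es os → top κ ≡ 2 * top es ⊔ topOdd os
merging-top []              = refl
merging-top (even refl b p) = sym (m≥n⇒m⊔n≡m (topOdd-≤ (proj₂ (merging-All⁻ p b))))
merging-top (odd refl b p)  = sym (m≤n⇒m⊔n≡n (topEven-≤ (proj₁ (merging-All⁻ p b))))

-- Sylvester's bijection

-- Restores the rows below the first after two hooks have been taken off: each surviving row regains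
-- two cells, so its half-length grows by 1, and z rows made of the middle cell alone return.
widen : ℕ → List ℕ → List ℕ
widen z α = map suc α ++ replicate z 0

widen-length : ∀ z α → length (widen z α) ≡ length α + z
widen-length z α = trans (length-++ (map suc α)) (cong₂ _+_ (length-map suc α) (length-replicate z))

replicate-0-sum : ∀ z → sum (replicate z 0) ≡ 0
replicate-0-sum zero    = refl
replicate-0-sum (suc z) = replicate-0-sum z

widen-sum : ∀ z α → sum (widen z α) ≡ length α + sum α
widen-sum z []      = replicate-0-sum z
widen-sum z (x ∷ α) = cong suc (trans (cong (x +_) (widen-sum z α)) (x∙yz≈y∙xz x (length α) (sum α)))

widen-All-≥ : ∀ z → All (x >_) α → All (x ≥_) (widen z α)
widen-All-≥ z b = Allₚ.++⁺ (Allₚ.map⁺ b) (Allₚ.replicate⁺ z z≤n)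

widen-All-≥⁻ : ∀ z α → All (x ≥_) (widen z α) → All (x >_) α
widen-All-≥⁻ z α = Allₚ.map⁻ ∘ Allₚ.++⁻ˡ (map suc α)

widen-nonincreasing : ∀ z → Nonincreasing α → Nonincreasing (widen z α)
widen-nonincreasing zero    []       = []
widen-nonincreasing (suc z) []       = Allₚ.replicate⁺ z z≤n ∷ widen-nonincreasing z []
widen-nonincreasing z       (b ∷ bs) = widen-All-≥ z (All.map s≤s b) ∷ widen-nonincreasing z bs

widen-injective : ∀ z z′ α α′ → widen z α ≡ widen z′ α′ → α ≡ α′ × z ≡ z′
widen-injective z       z′       []      []       e = refl ,
  trans (sym (length-replicate z)) (trans (cong length e) (length-replicate z′))
widen-injective (suc z) z′       []      (_ ∷ _)  ()
widen-injective z       (suc z′) (_ ∷ _) []       ()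
widen-injective z       z′       (x ∷ α) (x′ ∷ α′) e =
  let e₁ , e₂ = ∷-injective e
      f  , g  = widen-injective z z′ α α′ e₂
  in  cong₂ _∷_ (suc-injective e₁) f , g

all-zero : All (0 ≥_) xs → xs ≡ replicate (length xs) 0
all-zero []       = refl
all-zero (z≤n ∷ b) = cong (0 ∷_) (all-zero b)

-- In a nonincreasing list the zeros come last; z counts them, and the positive entries before them
-- drop by 1.
strip : Nonincreasing xs → ∃₂ λ z α → xs ≡ widen z α × Nonincreasing α
strip []                       = 0 , [] , refl , []
strip {zero ∷ xs}  (b ∷ _)     = suc (length xs) , [] , cong (0 ∷_) (all-zero b) , []
strip {suc x ∷ xs} (b ∷ bs) with strip bs
... | z , α , refl , cs = z , x ∷ α , refl , All.map s≤s⁻¹ (widen-All-≥⁻ z α b) ∷ cs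

-- Sylvester ν α: draw an odd part 2a + 1 for each entry a of α as a centred
-- row. The middle column together with the right half of the first row is u₁,
-- the left half of that row together with the column left of the middle is u₂,
-- and the rest is again such a diagram.
data Sylvester : List ℕ → List ℕ → Set where
  []  : Sylvester [] []
  one : xs ≡ replicate k 0 → Sylvester (suc k ∷ []) (0 ∷ xs)
  two : ∀ {a z u₁ u₂} → xs ≡ widen z α → All (suc a >_) α →
        u₁ ≡ suc a + suc (length α + z) → u₂ ≡ suc a + length α →
        Sylvester ν α → Sylvester (u₁ ∷ u₂ ∷ ν) (suc a ∷ xs)

sylvester-positive : Sylvester ν α → Positive ν
sylvester-positive []                     = []
sylvester-positive (one _)                = z<s ∷ []
sylvester-positive (two _ _ refl refl p)  = z<s ∷ z<s ∷ sylvester-positive p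

-- The first and largest hook is the first entry of α plus the number of entries.
sylvester-upper : Sylvester ν α → 0 < x → All (x >_) α → All (x + length α >_) ν
sylvester-upper []                     _   _        = []
sylvester-upper {x = x} (one {k = k} refl) 0<x _
  rewrite length-replicate k {0}                    = m<n+m (suc k) 0<x ∷ []
sylvester-upper {x = x} (two {α = α} {a = a} {z} refl b refl refl p) _ (a<x ∷ _) rewrite widen-length z α =
  +-monoˡ-< (suc (length α + z)) a<x ∷ u₂< ∷ All.map (λ v<u₂ → <-trans v<u₂ u₂<) (sylvester-upper p z<s b)
  where u₂< = +-mono-<-≤ a<x (m≤n⇒m≤1+n (m≤m+n (length α) z))

sylvester-decreasing : Sylvester ν α → Decreasing ν
sylvester-decreasing []                    = []
sylvester-decreasing (one _)               = [] ∷ []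
sylvester-decreasing (two {α = α} {a = a} {z} _ b refl refl p) =
  (u₂<u₁ ∷ All.map (λ v<u₂ → <-trans v<u₂ u₂<u₁) ν<u₂) ∷ ν<u₂ ∷ sylvester-decreasing p
  where
  u₂<u₁ = +-monoʳ-< (suc a) (s≤s (m≤m+n (length α) z))
  -- For x = `suc a` the upper bound is u₂ itself.
  ν<u₂  = sylvester-upper p z<s b

sylvester-nonincreasing : Sylvester ν α → Nonincreasing α
sylvester-nonincreasing []                        = []
sylvester-nonincreasing (one {k = k} refl)        = widen-nonincreasing (suc k) []
sylvester-nonincreasing (two {z = z} refl b _ _ p) =
  widen-All-≥ z b ∷ widen-nonincreasing z (sylvester-nonincreasing p)

-- The same identity for the first hook, read backwards. With x = u₂ the first conclusion leaves
-- room for a positive half-row, and the second makes that half-row long enough to lie above the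
-- widened α.
sylvester-lower : Sylvester ν α → 0 < x → All (x >_) ν → length α < x × All (λ a → x > a + length α) α
sylvester-lower []                 0<x _         = 0<x , []
sylvester-lower (one {k = k} refl)                _   (k<x ∷ _)
  rewrite length-replicate k {0}                                = k<x , k<x ∷ Allₚ.replicate⁺ k k<x
sylvester-lower (two {α = α} {a = a} {z} refl b refl _ _) _ (u₁<x ∷ _) rewrite widen-length z α =
  ≤-<-trans (m≤n+m _ (suc a)) u₁<x ,
  u₁<x ∷ All.map (λ v≤a → ≤-<-trans (+-monoˡ-≤ _ v≤a) u₁<x) (widen-All-≥ z b)

sylvester : ∀ ν → Decreasing ν → Positive ν → ∃[ α ] Sylvester ν α
sylvester []            _                     _            = _ , []
sylvester (suc k ∷ [])  _                     _            = _ , one refl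
sylvester (u₁ ∷ u₂ ∷ ν) ((u₂<u₁ ∷ _) ∷ b ∷ bs) (_ ∷ 0<u₂ ∷ ps)
  with sylvester ν bs ps
... | α , p with sylvester-lower p 0<u₂ b
-- The hook equations are solved for a and z: u₂ = `suc a + length α` and u₁ = `suc u₂ + z`.
... | l<u₂ , c with m≤n⇒∃[o]m+o≡n l<u₂ | m≤n⇒∃[o]m+o≡n u₂<u₁
... | a , refl | z , refl =
  _ , two refl (All.map (λ {v} lt → +-cancelʳ-< (length α) v (suc a) (subst (v + length α <_) eq lt)) c)
        (lemma (length α) a z) eq p
  where
  eq : suc (length α) + a ≡ suc a + length α
  eq = cong suc (+-comm (length α) a)
  lemma : ∀ l a z → suc (suc l + a) + z ≡ suc a + suc (l + z)
  lemma = solve-∀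

-- The bound k on the length makes the recursion structural.
sylvester⁻¹ : ∀ k α → length α ≤ k → Nonincreasing α → ∃[ ν ] Sylvester ν α
sylvester⁻¹ _       []          _       _        = _ , []
sylvester⁻¹ (suc k) (zero ∷ α)  _       (b ∷ _)  = _ , one (all-zero b)
sylvester⁻¹ (suc k) (suc a ∷ _) (s≤s l) (b ∷ bs) with strip bs
... | z , α , refl , cs =
  let α≤k   = ≤-trans (m≤m+n (length α) z) (subst (_≤ k) (widen-length z α) l)
      _ , p = sylvester⁻¹ k α α≤k cs
  in  _ , two refl (widen-All-≥⁻ z α b) refl refl p

-- The later hooks fix the inner diagram by induction; then u₂ fixes a, and u₁ fixes z.
sylvester-functional : Sylvester ν α → Sylvester ν α′ → α ≡ α′
sylvester-functional []         []         = refl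
sylvester-functional (one refl) (one refl) = refl
sylvester-functional (two {α = α} {a = a} {z} refl _ refl refl p) (two {a = a′} {z′} refl _ e₁ e₂ q)
  with sylvester-functional p q
... | refl with +-cancelʳ-≡ (length α) (suc a) (suc a′) e₂
... | refl with +-cancelˡ-≡ (length α) z z′ (suc-injective (+-cancelˡ-≡ (suc a) _ _ e₁))
... | refl = refl

sylvester-injective : Sylvester ν α → Sylvester ν′ α → ν ≡ ν′
sylvester-injective []      []                = refl
sylvester-injective (one {k = k} refl) (one {k = k′} e) = cong (λ k → suc k ∷ [])
  (trans (sym (length-replicate k)) (trans (cong length e) (length-replicate k′)))
sylvester-injective (two {α = α} {z = z} refl _ refl refl p) (two {α = α′} {z = z′} e _ refl refl q)
  with widen-injective z z′ α α′ e
... | refl , refl = cong (λ ν → _ ∷ _ ∷ ν) (sylvester-injective p q)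

-- By induction the bracket u₂ - ⋯ leaves the left half of the first row. Taking this off u₁, whose
-- right half is equally long, leaves the middle column, with one cell in every row.
sylvester-alternatingSum : Sylvester ν α → alternatingSum ν ≡ length α
sylvester-alternatingSum []                 = refl
sylvester-alternatingSum (one {k = k} refl) = cong suc (sym (length-replicate k))
sylvester-alternatingSum (two {α = α} {a = a} {z} refl _ refl refl p)
  rewrite sylvester-alternatingSum p | m+n∸n≡m (suc a) (length α) | widen-length z α =
  m+n∸m≡n (suc a) (suc (length α + z))

sylvester-residual : Sylvester ν α → residual ν ≡ topOdd α
sylvester-residual []                    = refl
sylvester-residual (one {k = k} _)       = cong (λ d → 2 * d + 1) (n∸n≡0 (suc k))
sylvester-residual p@(two {α = α} {a = a} {z} refl _ refl refl _)
  rewrite sylvester-alternatingSum p | widen-length z α = trans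
  (cong (λ d → 2 * d + 1) (m+n∸n≡m (suc a) (suc (length α + z)))) (+-comm (2 * suc a) 1)

sylvester-sum : Sylvester ν α → sum ν ≡ length α + 2 * sum α
sylvester-sum [] = refl
sylvester-sum (one {k = k} refl) rewrite length-replicate k {0} | replicate-0-sum k = refl
sylvester-sum (two {α = α} {a = a} {z} refl _ refl refl p)
  rewrite sylvester-sum p | widen-length z α | widen-sum z α = lemma a z (length α) (sum α)
  where
  lemma : ∀ a z l s → suc a + suc (l + z) + (suc a + l + (l + 2 * s)) ≡ suc (l + z) + 2 * (suc a + (l + s))
  lemma = solve-∀

-- The composite correspondence

-- Positivity of `pairs` is recorded because `conjugate` forgets zeros and is invertible only on
-- positive lists.
record Correspondence (xs κ : List ℕ) : Set where
  field
    {pairs singles halves} : List ℕ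
    isPairing   : Pairing xs pairs singles
    pairsPositive  : Positive pairs
    isSylvester : Sylvester singles halves
    isMerging   : Merging κ (conjugate pairs) halves

correspondence⁺ : Nonincreasing xs → Positive xs → ∃[ κ ] Correspondence xs κ
correspondence⁺ {xs} ps qs with unpair xs ps
... | μ , ν , p = _ , record
  { isPairing     = p
  ; pairsPositive = proj₁ positives
  ; isSylvester   = σ
  ; isMerging     = proj₂ (merge _ _ (conjugate-nonincreasing μ) (sylvester-nonincreasing σ))
  }
  where
  positives = pairing-All⁻ p qs
  σ         = proj₂ (sylvester ν (pairing-singles-decreasing p) (proj₂ positives))

correspondence⁻ : Nonincreasing κ → Positive κ → ∃[ xs ] Correspondence xs κ
correspondence⁻ ps qs with unmerge ps
... | es , os , m = _ , record
  { isPairing   = proj₂ (repair _ _ (conjugate-nonincreasing es) (sylvester-decreasing σ))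
  ; pairsPositive  = conjugate-positive es
  ; isSylvester = σ
  -- Here `pairs` is `conjugate es`, so the even halves appear as the double conjugate of `es`.
  ; isMerging   = subst (λ es → Merging _ es os) (sym (conjugate-involutive (merging-evens-nonincreasing m) es>0)) m
  }
  where
  σ    = proj₂ (sylvester⁻¹ (length os) os ≤-refl (merging-odds-nonincreasing m))
  es>0 = All.map (*-cancelˡ-< 2 0 _) (proj₁ (merging-All⁻ m qs))

correspondence-functional : Correspondence xs κ → Correspondence xs κ′ → κ ≡ κ′
correspondence-functional
  record { isPairing = p ; isSylvester = s ; isMerging = m }
  record { isPairing = q ; isSylvester = t ; isMerging = m′ }
  with pairing-functional p q
... | refl , refl with sylvester-functional s t
... | refl = merging-injective m m′

correspondence-injective : Correspondence xs κ → Correspondence ys κ → xs ≡ ys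
correspondence-injective
  record { pairs = μ ; isPairing = p ; pairsPositive = μ>0 ; isSylvester = s ; isMerging = m }
  record { pairs = μ′ ; isPairing = q ; pairsPositive = μ′>0 ; isSylvester = t ; isMerging = m′ }
  with merging-functional m m′
... | e , refl with sylvester-injective s t | μ≡μ′
  where
  μ≡μ′ : μ ≡ μ′
  μ≡μ′ = trans (sym (conjugate-involutive (pairing-pairs-nonincreasing p) μ>0))
    (trans (cong conjugate e) (conjugate-involutive (pairing-pairs-nonincreasing q) μ′>0))
... | refl | refl = pairing-injective p q

module _ (c : Correspondence xs κ) where
  open Correspondence c

  source-nonincreasing : Nonincreasing xs
  source-nonincreasing = pairing-nonincreasing isPairing

  source-positive : Positive xs
  source-positive = pairing-All⁺ isPairing pairsPositive (sylvester-positive isSylvester)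

  target-nonincreasing : Nonincreasing κ
  target-nonincreasing = merging-nonincreasing isMerging

  target-positive : Positive κ
  target-positive = merging-All⁺ isMerging
    (All.map (*-monoʳ-< 2) (conjugate-positive pairs)) (All.universal (λ _ → z<s) halves)

  correspondence-sum : sum xs ≡ sum κ
  correspondence-sum = begin
    sum xs                                                         ≡⟨ pairing-sum isPairing ⟩
    2 * sum pairs + sum singles                                    ≡⟨ cong₂ (λ s t → 2 * s + t) (sym (conjugate-sum pairs)) (sylvester-sum isSylvester) ⟩
    2 * sum (conjugate pairs) + (length halves + 2 * sum halves)   ≡⟨ merging-sum isMerging ⟨
    sum κ                                                          ∎
    where open ≡-Reasoning

  correspondence-index : max 0 (pairedSizes xs) + alternatingSum (unpairedParts xs) ≡ length κ
  correspondence-index = begin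
    max 0 (pairedSizes xs) + alternatingSum (unpairedParts xs)
      ≡⟨ cong₂ (λ r us → r + alternatingSum us) (pairing-pairedSizes isPairing) (pairing-unpairedParts isPairing) ⟩
    top pairs + alternatingSum singles
      ≡⟨ cong₂ _+_ (sym (conjugate-length (pairing-pairs-nonincreasing isPairing))) (sylvester-alternatingSum isSylvester) ⟩
    length (conjugate pairs) + length halves
      ≡⟨ merging-length isMerging ⟨
    length κ ∎
    where open ≡-Reasoning

  correspondence-width : pairedTotal xs (partSizes xs) ⊔ residual (unpairedParts xs) ≡ max 0 κ
  correspondence-width = begin
    pairedTotal xs (partSizes xs) ⊔ residual (unpairedParts xs)
      ≡⟨ cong₂ (λ w us → w ⊔ residual us) (pairing-pairSpan isPairing) (pairing-unpairedParts isPairing) ⟩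
    2 * length pairs ⊔ residual singles
      ≡⟨ cong₂ (λ l o → 2 * l ⊔ o) (sym (conjugate-top pairsPositive)) (sylvester-residual isSylvester) ⟩
    2 * top (conjugate pairs) ⊔ topOdd halves
      ≡⟨ merging-top isMerging ⟨
    top κ
      ≡⟨ nonincreasing⇒max≡top target-nonincreasing ⟨
    max 0 κ ∎
    where open ≡-Reasoning

-- Partitions with prescribed statistics

open Partition

Refined : (n : ℕ) (f g : Partition n → ℕ) (a b : ℕ) → Set
Refined n f g a b = Σ[ p ∈ Partition n ] (f p ≡ a × g p ≡ b)

partition-≡ : {p q : Partition n} → parts p ≡ parts q → p ≡ q
partition-≡ {p = record { nonincreasing = l ; positive = p ; total = t }}
            {q = record { nonincreasing = l′ ; positive = p′ ; total = t′ }} refl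
  with refl ← Linked.irrelevant ≤-irrelevant l l′
     | refl ← All.irrelevant <-irrelevant p p′
     | refl ← ≡-irrelevant t t′ = refl

refined-≡ : ∀ {f g : Partition n → ℕ} {a b} {s t : Refined n f g a b} →
  parts (proj₁ s) ≡ parts (proj₁ t) → s ≡ t
refined-≡ {s = p , u , v} {t = q , u′ , v′} e with partition-≡ {p = p} {q} e
... | refl = cong₂ (λ u v → p , u , v) (≡-irrelevant u u′) (≡-irrelevant v v′)

sorted : (p : Partition n) → Nonincreasing (parts p)
sorted p = Linked⇒AllPairs (flip ≤-trans) (nonincreasing p)

-- In a round trip the intermediate list is related both to the start and to the result, so
-- single-valuedness identifies these.
correspondence-↔ : ∀ n a b →
  Refined n pairingIndex pairingWidth a b ↔ Refined n numberOfParts largestPart a b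
correspondence-↔ n a b = mk↔ₛ′ to from
  (λ t → refined-≡ (correspondence-functional (related⁺ (from t)) (related⁻ t)))
  (λ s → refined-≡ (correspondence-injective (related⁻ (to s)) (related⁺ s)))
  where
  image : (p : Partition n) → ∃[ κ ] Correspondence (parts p) κ
  image p = correspondence⁺ (sorted p) (positive p)

  preimage : (p : Partition n) → ∃[ xs ] Correspondence xs (parts p)
  preimage p = correspondence⁻ (sorted p) (positive p)

  to : Refined n pairingIndex pairingWidth a b → Refined n numberOfParts largestPart a b
  to (p , i , w) = let κ , c = image p in record
    { parts         = κ
    ; nonincreasing = AllPairs⇒Linked (target-nonincreasing c)
    ; positive      = target-positive c
    ; total         = trans (sym (correspondence-sum c)) (total p)
    } , trans (sym (correspondence-index c)) i , trans (sym (correspondence-width c)) w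

  from : Refined n numberOfParts largestPart a b → Refined n pairingIndex pairingWidth a b
  from (p , i , w) = let xs , c = preimage p in record
    { parts         = xs
    ; nonincreasing = AllPairs⇒Linked (source-nonincreasing c)
    ; positive      = source-positive c
    ; total         = trans (correspondence-sum c) (total p)
    } , trans (correspondence-index c) i , trans (correspondence-width c) w

  related⁺ : ∀ s → Correspondence (parts (proj₁ s)) (parts (proj₁ (to s)))
  related⁺ (p , _) = proj₂ (image p)

  related⁻ : ∀ t → Correspondence (parts (proj₁ (from t))) (parts (proj₁ t))
  related⁻ (p , _) = proj₂ (preimage p)

-- Finiteness

unique-index : {A : Set} {x : A} {xs : List A} → Unique xs → (x∈xs : x ∈ xs) (i : Fin (length xs)) →
  x ≡ lookup xs i → index x∈xs ≡ i
unique-index (_ ∷ _)   (here _)     Fin.zero    _    = refl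
unique-index (x∉ ∷ _)  (here refl)  (Fin.suc i) e    = contradiction e (All.lookup x∉ (∈-lookup i))
unique-index (x∉ ∷ _)  (there x∈xs) Fin.zero    refl = contradiction refl (All.lookup x∉ x∈xs)
unique-index (_ ∷ xs!) (there x∈xs) (Fin.suc i) e    = cong Fin.suc (unique-index xs! x∈xs i e)

-- Counts A through its image under an injection. Here f takes the parts, so partitions with their
-- proofs are counted as plain lists.
unique-↔ : {A B : Set} {f : A → B} → (∀ {s t} → f s ≡ f t → s ≡ t) →
  (ys : List B) → Unique ys → (∀ s → f s ∈ ys) → (∀ {y} → y ∈ ys → ∃[ s ] f s ≡ y) → A ↔ Fin (length ys)
unique-↔ f-injective ys ys! f∈ys preimage = mk↔ₛ′
  (λ s → index (f∈ys s))
  (λ i → proj₁ (preimage (∈-lookup i)))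
  (λ i → unique-index ys! (f∈ys _) i (proj₂ (preimage (∈-lookup i))))
  (λ s → f-injective (trans (proj₂ (preimage (∈-lookup (index (f∈ys s))))) (sym (lookup-index (f∈ys s)))))

boundedLists : (maxLength maxEntry : ℕ) → List (List ℕ)
boundedLists zero    m = [] ∷ []
boundedLists (suc l) m = [] ∷ cartesianProductWith _∷_ (upTo (suc m)) (boundedLists l m)

∈-boundedLists : ∀ l → length xs ≤ l → All (m ≥_) xs → xs ∈ boundedLists l m
∈-boundedLists zero    z≤n     []       = here refl
∈-boundedLists (suc l) z≤n     []       = here refl
∈-boundedLists (suc l) (s≤s p) (b ∷ bs) =
  there (∈-cartesianProductWith⁺ _∷_ (∈-upTo⁺ (s≤s b)) (∈-boundedLists l p bs))

length≤sum : Positive xs → length xs ≤ sum xs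
length≤sum []       = z≤n
length≤sum (p ∷ ps) = +-mono-≤ p (length≤sum ps)

parts≤sum : ∀ xs → All (sum xs ≥_) xs
parts≤sum []       = []
parts≤sum (x ∷ xs) = m≤m+n x (sum xs) ∷ All.map (λ p → ≤-trans p (m≤n+m (sum xs) x)) (parts≤sum xs)

refined-finite : ∀ n a b → ∃[ k ] HasCardinality (Refined n numberOfParts largestPart a b) k
refined-finite n a b = _ , unique-↔ (refined-≡ {f = numberOfParts} {largestPart})
  -- Removing duplicates yields the `Unique` list that counting requires.
  (deduplicate _≟ₗ_ solutions) (deduplicate-! _≟ₗ_ solutions)
  (∈-deduplicate⁺ _≟ₗ_ ∘ complete) (sound ∘ ∈-deduplicate⁻ _≟ₗ_ solutions)
  where
  _≟ₗ_ = ≡-dec _≟_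

  Valid : List ℕ → Set
  Valid xs = Linked _≥_ xs × Positive xs × sum xs ≡ n × length xs ≡ a × max 0 xs ≡ b

  valid? : ∀ xs → Dec (Valid xs)
  valid? xs = Linked.linked? _≥?_ xs ×-dec All.all? (0 <?_) xs ×-dec
    (sum xs ≟ n) ×-dec (length xs ≟ a) ×-dec (max 0 xs ≟ b)

  solutions : List (List ℕ)
  -- Positive parts with sum n are at most n in number and at most n in size.
  solutions = filter valid? (boundedLists n n)

  complete : (s : Refined n numberOfParts largestPart a b) → parts (proj₁ s) ∈ solutions
  complete (record { parts = xs ; nonincreasing = l ; positive = p ; total = refl } , i , w) =
    ∈-filter⁺ valid? (∈-boundedLists n (length≤sum p) (parts≤sum xs)) (l , p , refl , i , w)

  sound : xs ∈ solutions → Σ[ s ∈ Refined n numberOfParts largestPart a b ] parts (proj₁ s) ≡ xs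
  sound xs∈ with ∈-filter⁻ valid? {xs = boundedLists n n} xs∈
  ... | _ , l , p , t , i , w =
    (record { nonincreasing = l ; positive = p ; total = t } , i , w) , refl

theorem2p6 : ∀ (n a b : ℕ) → ∃[ k ]
    (HasCardinality (Σ[ p ∈ Partition n ] (pairingIndex p ≡ a × pairingWidth p ≡ b)) k ×
    HasCardinality (Σ[ p ∈ Partition n ] (numberOfParts p ≡ a × largestPart p ≡ b)) k)
theorem2p6 n a b =
  let k , finite = refined-finite n a b
  in  k , ↔-trans (correspondence-↔ n a b) finite , finite
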